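{- Let $\Omega$ be a divisible ML-algebra, let $\alpha:A$ and $\beta:B$ be $\Omega$-sets, let $f:A\rightharpoonup B$ be a multi-morphism that is total in $\alpha:A$ and faithful in $\beta:B$, and let $a$ and $b$ be observable descriptions of entities in $\alpha:A$ and $\beta:B$, respectively. Then the equations 1. $[a]_\alpha\otimes f(\beta|a)=f(a,\_)$ in the unknown $f(\beta|a):B\to\Omega$, and 2. $[b]_\beta\otimes f(\alpha|b)=f(\_,b)$ in the unknown $f(\alpha|b):A\to\Omega$ (both understood pointwise) have a solution, and they define $\Omega$-maps $f(\beta|a):B\to\Omega$ and $f(\alpha|b):A\to\Omega$ given by $$f(\beta|a)=\big([a]_\alpha\Rightarrow f(a,\_)\big),\qquad f(\alpha|b)=\big([b]_\beta\Rightarrow f(\_,b)\big).$$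
   Context: An ML-algebra is a system $(\Omega,\otimes,\Rightarrow,\vee,\wedge,\bot,\top)$ such that $(\Omega,\otimes,\top)$ is a commutative monoid, $(\Omega,\vee,\wedge,\bot,\top)$ is a bounded lattice, and $x\le (y\Rightarrow z)$ iff $x\otimes y\le z$ for all $x,y,z$. The lattice is assumed complete and $\top\ne\bot$. It is divisible if $x\otimes(x\Rightarrow y)=x\wedge y$ for all $x,y$. An $\Omega$-set $\alpha:A$ is a set $A$ with a map $[\cdot=\cdot]_\alpha:A\times A\to\Omega$ satisfying $[x=y]_\alpha=[y=x]_\alpha$ and $[x=y]_\alpha\otimes[y=z]_\alpha\le[x=z]_\alpha$. The extent of $x\in A$ is $[x]_\alpha=[x=x]_\alpha$. A multi-morphism $f:A\rightharpoonup B$ is a map $f:A\times B\to\Omega$. It is total in $\alpha:A$ if $[x]_\alpha=\bigvee_{y\in B}f(x,y)$ for every $x\in A$, and faithful in $\beta:B$ if $[y]_\beta=\bigvee_{x\in A}f(x,y)$ for every $y\in B$. Observable descriptions: if $A=\prod_{i\in I}A_i$ and a subset $L\subseteq I$ of attributes is declared observable, an observable description of an entity in $\alpha:A$ is an element $a\in\prod_{i\in L}A_i$. Write $x=(c,a)$ for an element $x\in A$ whose observable part is $a$. The similarity is extended to observable descriptions by $[a=a']_\alpha=\bigvee_{x=(c,a),\,y=(d,a')\in A}[x=y]_\alpha$, with $[a]_\alpha=[a=a]_\alpha$. The same applies to $\beta:B$. The map $f$ is extended to observable descriptions by taking joins over all elements with the given observable part: $f(a,y)=\bigvee_{x=(c,a)}f(x,y)$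 for $y\in B$, and $f(x,b)=\bigvee_{y=(d,b)}f(x,y)$ for $x\in A$. Then $f(a,\_):B\to\Omega$ is the map $y\mapsto f(a,y)$ and $f(\_,b):A\to\Omega$ is the map $x\mapsto f(x,b)$. -}

module Defs where

open import Algebra.Core using (Op₂)
open import Algebra.Structures using (IsCommutativeMonoid)
open import Data.Product using (Σ-syntax; _×_; _,_; proj₁; proj₂)
open import Level using (Level; _⊔_) renaming (suc to lsuc)
open import Relation.Binary.Core using (Rel)
open import Relation.Binary.Lattice.Definitions using (Exponential)
open import Relation.Binary.Lattice.Structures using (IsBoundedLattice)
open import Relation.Binary.PropositionalEquality using (_≡_)
open import Relation.Nullary using (¬_)
open import Relation.Unary using (Pred; _∈_)

-- Completeness is relative to the universe Set ι of index types: every family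
-- K → Carrier with K : Set ι has a supremum and an infimum.  No relation
-- between ι and the levels of the carrier is imposed, since for example
-- truth values in Set ι form a carrier in a larger universe than ι.

record MLAlgebra (c ℓ₁ ℓ₂ ι : Level) : Set (lsuc (c ⊔ ℓ₁ ⊔ ℓ₂ ⊔ ι)) where
  infix  4 _≈_ _≤_
  infixr 5 _⇒_
  infixr 6 _∨_
  infixr 7 _∧_ _⊗_
  field
    Carrier : Set c
    _≈_     : Rel Carrier ℓ₁
    _≤_     : Rel Carrier ℓ₂
    _⊗_     : Op₂ Carrier
    _⇒_     : Op₂ Carrier
    _∨_     : Op₂ Carrier
    _∧_     : Op₂ Carrier
    ⊥       : Carrier
    ⊤       : Carrier
    ⊗-isCommutativeMonoid : IsCommutativeMonoid _≈_ _⊗_ ⊤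
    isBoundedLattice      : IsBoundedLattice _≈_ _≤_ _∨_ _∧_ ⊤ ⊥
    residuation           : Exponential _≤_ _⊗_ _⇒_
    ⋁       : {K : Set ι} → (K → Carrier) → Carrier
    ⋁-upper : {K : Set ι} (s : K → Carrier) (k : K) → s k ≤ ⋁ s
    ⋁-least : {K : Set ι} (s : K → Carrier) {z : Carrier} →
              (∀ k → s k ≤ z) → ⋁ s ≤ z
    ⋀          : {K : Set ι} → (K → Carrier) → Carrier
    ⋀-lower    : {K : Set ι} (s : K → Carrier) (k : K) → ⋀ s ≤ s k
    ⋀-greatest : {K : Set ι} (s : K → Carrier) {z : Carrier} →
                 (∀ k → z ≤ s k) → z ≤ ⋀ s
    ⊤≉⊥     : ¬ (⊤ ≈ ⊥)

  Divisible : Set (c ⊔ ℓ₁)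
  Divisible = ∀ x y → x ⊗ (x ⇒ y) ≈ x ∧ y

-- The product of the attribute sets A i.

∏ : {ι : Level} {I : Set ι} → (I → Set ι) → Set ι
∏ {I = I} A = (i : I) → A i

-- Elements of the product of the A i over i ∈ L.  The membership proof is
-- irrelevant, so that a component depends on i only.

Description : {ι : Level} {I : Set ι} → Pred I ι → (I → Set ι) → Set ι
Description {I = I} L A = (i : I) → .(i ∈ L) → A i

-- The elements x = (c , a) of the product, those whose observable part is a.

Fibre : {ι : Level} {I : Set ι} (L : Pred I ι) (A : I → Set ι) →
        Description L A → Set ι
Fibre L A a = Σ[ x ∈ ∏ A ] (∀ i (i∈L : i ∈ L) → x i ≡ a i i∈L)

module OmegaSets {c ℓ₁ ℓ₂ ι : Level} (Ω : MLAlgebra c ℓ₁ ℓ₂ ι) where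

  open MLAlgebra Ω

  record ΩSet (A : Set ι) : Set (c ⊔ ℓ₁ ⊔ ℓ₂ ⊔ ι) where
    field
      sim       : A → A → Carrier
      sim-sym   : ∀ x y → sim x y ≈ sim y x
      sim-trans : ∀ x y z → sim x y ⊗ sim y z ≤ sim x z

    extent : A → Carrier
    extent x = sim x x

  open ΩSet

  ΩMap : Set ι → Set (c ⊔ ι)
  ΩMap A = A → Carrier

  _⇀_ : Set ι → Set ι → Set (c ⊔ ι)
  A ⇀ B = A → B → Carrier

  TotalIn : {A B : Set ι} → ΩSet A → A ⇀ B → Set (ℓ₁ ⊔ ι)
  TotalIn α f = ∀ x → extent α x ≈ ⋁ (λ y → f x y)

  FaithfulIn : {A B : Set ι} → ΩSet B → A ⇀ B → Set (ℓ₁ ⊔ ι)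
  FaithfulIn β f = ∀ y → extent β y ≈ ⋁ (λ x → f x y)

  module _ {I : Set ι} (L : Pred I ι) {A : I → Set ι} where

    simᵈ : ΩSet (∏ A) → Description L A → Description L A → Carrier
    simᵈ α a a′ = ⋁ {K = Fibre L A a × Fibre L A a′}
                    (λ (x , y) → sim α (proj₁ x) (proj₁ y))

    extentᵈ : ΩSet (∏ A) → Description L A → Carrier
    extentᵈ α a = simᵈ α a a

    extendˡ : {B : Set ι} → ∏ A ⇀ B → Description L A → ΩMap B
    extendˡ f a y = ⋁ {K = Fibre L A a} (λ x → f (proj₁ x) y)

    extendʳ : {B : Set ι} → B ⇀ ∏ A → Description L A → ΩMap B
    extendʳ f a x = ⋁ {K = Fibre L A a} (λ y → f x (proj₁ y))

{-# OPTIONS --safe #-}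

-- An entity x with observable part a satisfies f(x,y) ≤ [x] ≤ [a] by totality,
-- so f(a,y) ≤ [a]; divisibility turns [a] ⊗ ([a] ⇒ f(a,y)) into the meet of
-- [a] and f(a,y), which is f(a,y).  The second equation is the first one for
-- the transpose of f, since faithfulness of f is totality of its transpose.

module Submission where

open import Defs
open import Function using (flip)
open import Level using (Level)
open import Data.Product using (Σ-syntax; _×_; _,_)
open import Relation.Binary.Lattice.Structures using (IsBoundedLattice)
open import Relation.Unary using (Pred)

module _ {c ℓ₁ ℓ₂ ι : Level} (Ω : MLAlgebra c ℓ₁ ℓ₂ ι) where

  open MLAlgebra Ω
  open OmegaSets Ω
  open IsBoundedLattice isBoundedLattice

  ≤⇒⊗-⇒ : Divisible → ∀ {x y} → y ≤ x → x ⊗ (x ⇒ y) ≈ y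
  ≤⇒⊗-⇒ div {x} {y} y≤x =
    Eq.trans (div x y) (antisym (x∧y≤y x y) (∧-greatest y≤x refl))

  module _ {I : Set ι} (L : Pred I ι) {A : I → Set ι} {B : Set ι}
           (α : ΩSet (∏ A)) (f : ∏ A ⇀ B) (total : TotalIn α f)
           (a : Description L A) where

    extendˡ≤extentᵈ : ∀ y → extendˡ L f a y ≤ extentᵈ L α a
    extendˡ≤extentᵈ y = ⋁-least _ λ p@(x , _) →
      trans (⋁-upper (f x) y)
        -- The join defining `extentᵈ` runs over pairs from the fibre of `a`; its diagonal term at
        -- `p` is the extent of `x`.
        (trans (reflexive (Eq.sym (total x))) (⋁-upper _ (p , p)))

    -- The equation alone may have several solutions; the last component singles out the residual,
    -- the largest of them.
    residual-solves : Divisible →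
      Σ[ g ∈ ΩMap B ]
        (∀ y → extentᵈ L α a ⊗ g y ≈ extendˡ L f a y)
        × (∀ y → g y ≈ (extentᵈ L α a ⇒ extendˡ L f a y))
    residual-solves div =
      (λ y → extentᵈ L α a ⇒ extendˡ L f a y) ,
      (λ y → ≤⇒⊗-⇒ div (extendˡ≤extentᵈ y)) ,
      (λ _ → Eq.refl)

proposition4 :
    {c ℓ₁ ℓ₂ ι : Level} (Ω : MLAlgebra c ℓ₁ ℓ₂ ι) →
    let open MLAlgebra Ω
        open OmegaSets Ω
    in
    Divisible →
    {I J : Set ι} (A : I → Set ι) (B : J → Set ι)
    (L : Pred I ι) (M : Pred J ι)
    (α : ΩSet (∏ A)) (β : ΩSet (∏ B)) (f : ∏ A ⇀ ∏ B) →
    TotalIn α f → FaithfulIn β f →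
    (a : Description L A) (b : Description M B) →
    (Σ[ fβ∣a ∈ ΩMap (∏ B) ]
       (∀ y → extentᵈ L α a ⊗ fβ∣a y ≈ extendˡ L f a y)
       × (∀ y → fβ∣a y ≈ (extentᵈ L α a ⇒ extendˡ L f a y)))
    ×
    (Σ[ fα∣b ∈ ΩMap (∏ A) ]
       (∀ x → extentᵈ M β b ⊗ fα∣b x ≈ extendʳ M f b x)
       × (∀ x → fα∣b x ≈ (extentᵈ M β b ⇒ extendʳ M f b x)))
proposition4 Ω div A B L M α β f total faithful a b =
  residual-solves Ω L α f total a div ,
  -- `faithful` and the joins in `extendʳ` fit as they stand: both unfold to their left-hand
  -- versions for `flip f`.
  residual-solves Ω M β (flip f) faithful b div
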